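{- Let $t,\Delta,\omega$ be integers with $\Delta\ge 2$ and $2\le t\le\omega$. If $\omega-1$ divides $\Delta$, then \[ f_t(\Delta,\omega)=\rho_t\!\left(T_\omega\!\left(\Delta+\tfrac{\Delta}{\omega-1}\right)\right). \]
   Context: All graphs are finite and simple. For integers $\Delta,\omega$, let $\mathcal{G}(\Delta,\omega)$ be the class of graphs $G$ with maximum degree $\Delta(G)\le\Delta$ and clique number $\omega(G)\le\omega$. For a graph $G$, $k_t(G)$ denotes the number of copies of $K_t$ (complete subgraphs on $t$ vertices) in $G$, and $\rho_t(G)=k_t(G)/|V(G)|$. For a positive integer $n$ let $k_t(n,\Delta,\omega)=\max\{k_t(G): |V(G)|=n,\ G\in\mathcal{G}(\Delta,\omega)\}$, and define $f_t(\Delta,\omega)=\lim_{n\to\infty}k_t(n,\Delta,\omega)/n$ (this limit exists and equals $\sup_{n}k_t(n,\Delta,\omega)/n$). $T_r(n)$ denotes the Turán graph: the complete $r$-partite graph on $n$ vertices whose part sizes differ by at most one. -}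

module Defs where

open import Data.Bool using (Bool; true; false; not; _∧_; _∨_; if_then_else_)
open import Data.Nat using (ℕ; zero; suc; _+_; _*_; _∸_; _≤_; _≡ᵇ_; _%_)
open import Data.Fin using (Fin; toℕ)
open import Data.Fin.Subset using (Subset; ∣_∣)
open import Data.Vec using (Vec; []; _∷_; lookup)
open import Data.List using (List; []; _∷_; map; _++_; length; filterᵇ; allFin)
open import Data.Product using (Σ; ∃; _×_; _,_)
open import Relation.Binary.PropositionalEquality using (_≡_)
open import Data.Nat.Divisibility using (_∣_; quotient)

Graph : ℕ → Set
Graph n = Fin n → Fin n → Bool

Simple : ∀ {n} → Graph n → Set
Simple {n} G = (∀ (i j : Fin n) → G i j ≡ G j i) × (∀ (i : Fin n) → G i i ≡ false)

allSubsets : (n : ℕ) → List (Subset n)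
allSubsets zero = [] ∷ []
allSubsets (suc n) = map (true ∷_) (allSubsets n) ++ map (false ∷_) (allSubsets n)

allᵇ : {A : Set} → (A → Bool) → List A → Bool
allᵇ p [] = true
allᵇ p (x ∷ xs) = p x ∧ allᵇ p xs

eqFin : ∀ {n} → Fin n → Fin n → Bool
eqFin i j = toℕ i ≡ᵇ toℕ j

isCliqueᵇ : ∀ {n} → Graph n → Subset n → Bool
isCliqueᵇ {n} G S =
  allᵇ (λ i → allᵇ (λ j → not (lookup S i ∧ lookup S j ∧ not (eqFin i j)) ∨ G i j) (allFin n)) (allFin n)

kt : ∀ {n} → ℕ → Graph n → ℕ
kt {n} t G = length (filterᵇ (λ S → (∣ S ∣ ≡ᵇ t) ∧ isCliqueᵇ G S) (allSubsets n))

degree : ∀ {n} → Graph n → Fin n → ℕ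
degree {n} G v = length (filterᵇ (G v) (allFin n))

InClass : ∀ {n} → ℕ → ℕ → Graph n → Set
InClass {n} Δ ω G =
  Simple G × (∀ (v : Fin n) → degree G v ≤ Δ)
           × (∀ (S : Subset n) → isCliqueᵇ G S ≡ true → ∣ S ∣ ≤ ω)

IsKtMax : (t n Δ ω m : ℕ) → Set
IsKtMax t n Δ ω m =
  (Σ (Graph n) λ G → InClass Δ ω G × kt t G ≡ m)
  × (∀ (G : Graph n) → InClass Δ ω G → kt t G ≤ m)

-- a / b (with b ≥ 1) is an upper bound of { k_t(n,Δ,ω) / n : n ≥ 1 }.
UpperBd : (t Δ ω a b : ℕ) → Set
UpperBd t Δ ω a b = ∀ (n m : ℕ) → 1 ≤ n → IsKtMax t n Δ ω m → m * b ≤ a * n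

-- f_t(Δ, ω) = a / b, where f_t = sup_n k_t(n,Δ,ω)/n (= the limit):
-- a/b is an upper bound and is ≤ every (rational) upper bound a'/b'.
FtEq : (t Δ ω a b : ℕ) → Set
FtEq t Δ ω a b =
  UpperBd t Δ ω a b
  × (∀ (a' b' : ℕ) → 1 ≤ b' → UpperBd t Δ ω a' b' → a * b' ≤ a' * b)

-- Turán graph T_r(N): vertex i lies in part (i mod r); vertices adjacent iff in
-- different parts. Part sizes then differ by at most one. (r = 0 unused.)
turan : ℕ → (N : ℕ) → Graph N
turan zero N i j = false
turan (suc r) N i j = not ((toℕ i % suc r) ≡ᵇ (toℕ j % suc r))

turanSize : (Δ ω : ℕ) → (ω ∸ 1) ∣ Δ → ℕ
turanSize Δ ω h = Δ + quotient h

{-# OPTIONS --safe #-}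

-- In a graph of the class, every neighbourhood has at most Δ vertices and clique number at most ω − 1,
-- so Zykov's theorem bounds the number of (t − 1)-cliques inside it by C(ω − 1, t − 1) d ^ (t − 1),
-- where d = Δ / (ω − 1).  Summing over all vertices counts each t-clique t times, and the resulting
-- density is attained by the Turán graph, whose ω parts have size d.
-- Zykov's theorem itself follows by induction on the clique number: choose v whose neighbourhood A
-- contains the most (s − 1)-cliques; each s-clique lies in A or passes through a vertex outside A, so
-- k_s(G) ≤ k_s(A) + (n − |A|) k_{s−1}(A), and the induction hypothesis for A and AM-GM finish.
-- All cliques are counted as ordered tuples, which makes these counts recursive in s.
module Submission where

open import Defs
open import Data.Bool using (Bool; true; false; not; _∧_; _∨_; if_then_else_)
open import Data.Bool.Properties using (∧-comm; T-≡)
open import Data.Empty using (⊥-elim)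
open import Data.Fin using (Fin; zero; suc; toℕ)
open import Data.Fin.Properties using (toℕ-injective; toℕ<n) renaming (_≟_ to _≟ꟳ_)
open import Data.Fin.Subset using (Subset; ∣_∣; ⊥)
open import Data.List using ([]; _∷_; _++_; map; length; filterᵇ; tabulate; allFin)
open import Data.List.Properties using (length-++; filter-++)
open import Data.Nat
open import Data.Nat.DivMod using ([m+n]%n≡m%n; m<n⇒m%n≡m; m%n<n)
open import Data.Nat.Divisibility using (_∣_; divides)
open import Data.Nat.Properties
open import Data.Nat.Tactic.RingSolver using (solve-∀)
open import Data.Product using (∃; _×_; _,_; proj₁; proj₂)
open import Data.Sum using (_⊎_; inj₁; inj₂)
open import Data.Vec using ([]; _∷_; lookup; _[_]≔_)
open import Data.Vec.Properties using (lookup∘updateAt; lookup∘updateAt′; lookup-replicate)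
open import Function using (_∘_; id; Equivalence; _⇔_; mk⇔)
open import Relation.Binary.PropositionalEquality
open import Relation.Nullary using (yes; no)
open import Relation.Nullary.Decidable using (T?)
open import Algebra.Properties.Semiring.Sum +-*-semiring
  using (sum; sum-cong-≗; sum-replicate-zero; ∑-distrib-+; ∑-comm; *-distribˡ-sum; *-distribʳ-sum)

open Equivalence using (to; from)

-- Indicators, finite sums and vertex sets as Boolean predicates.

χ : Bool → ℕ
χ b = if b then 1 else 0

χ-∧ : ∀ a b → χ (a ∧ b) ≡ χ a * χ b
χ-∧ true b = sym (+-identityʳ (χ b))
χ-∧ false b = refl

χ-split : ∀ a b x → χ a * x ≡ χ (a ∧ b) * x + χ a * (χ (not b) * x)
χ-split true true x = sym (+-identityʳ _)
χ-split true false x = sym (+-identityʳ _)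
χ-split false b x = refl

χ*≤ : ∀ b x → χ b * x ≤ x
χ*≤ true x = ≤-reflexive (+-identityʳ x)
χ*≤ false x = z≤n

χ*-mono : ∀ b {x y} → (b ≡ true → x ≤ y) → χ b * x ≤ χ b * y
χ*-mono true x≤y = *-monoʳ-≤ 1 (x≤y refl)
χ*-mono false _ = z≤n

χ*-cong : ∀ b {x y} → (b ≡ true → x ≡ y) → χ b * x ≡ χ b * y
χ*-cong true x≡y = cong (1 *_) (x≡y refl)
χ*-cong false _ = refl

sum-mono-≤ : ∀ {n} {f g : Fin n → ℕ} → (∀ i → f i ≤ g i) → sum f ≤ sum g
sum-mono-≤ {zero} f≤g = z≤n
sum-mono-≤ {suc n} f≤g = +-mono-≤ (f≤g zero) (sum-mono-≤ (f≤g ∘ suc))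

sum-const : ∀ n c → sum {n} (λ _ → c) ≡ n * c
sum-const zero c = refl
sum-const (suc n) c = cong (c +_) (sum-const n c)

sum-zero : ∀ {n} {f : Fin n → ℕ} → (∀ i → f i ≡ 0) → sum f ≡ 0
sum-zero {n} f≡0 = trans (sum-cong-≗ f≡0) (sum-replicate-zero n)

sum≡0⇒ : ∀ {n} {f : Fin n → ℕ} → sum f ≡ 0 → ∀ i → f i ≡ 0
sum≡0⇒ {suc n} {f} eq zero = m+n≡0⇒m≡0 (f zero) eq
sum≡0⇒ {suc n} {f} eq (suc i) = sum≡0⇒ (m+n≡0⇒n≡0 (f zero) eq) i

true≢false : true ≢ false
true≢false ()

argmax : ∀ {n} (B : Fin n → Bool) (f : Fin n → ℕ) →
  (∀ u → B u ≡ false) ⊎ ∃ λ v → B v ≡ true × (∀ u → B u ≡ true → f u ≤ f v)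
argmax {zero} B f = inj₁ λ ()
argmax {suc n} B f with B zero in eq | argmax (B ∘ suc) (f ∘ suc)
... | false | inj₁ none = inj₁ λ { zero → eq ; (suc u) → none u }
... | false | inj₂ (v , Bv , max) = inj₂ (suc v , Bv , λ
        { zero B0 → ⊥-elim (true≢false (trans (sym B0) eq)) ; (suc u) Bu → max u Bu })
... | true | inj₁ none = inj₂ (zero , eq , λ
        { zero _ → ≤-refl ; (suc u) Bu → ⊥-elim (true≢false (trans (sym Bu) (none u))) })
... | true | inj₂ (v , Bv , max) with ≤-total (f zero) (f (suc v))
...   | inj₁ 0≤v = inj₂ (suc v , Bv , λ { zero _ → 0≤v ; (suc u) Bu → max u Bu })
...   | inj₂ v≤0 = inj₂ (zero , eq , λ { zero _ → ≤-refl ; (suc u) Bu → ≤-trans (max u Bu) v≤0 })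

infixl 7 _∩_

_∩_ : ∀ {n} → (Fin n → Bool) → (Fin n → Bool) → Fin n → Bool
(A ∩ B) i = A i ∧ B i

card : ∀ {n} → (Fin n → Bool) → ℕ
card A = sum (χ ∘ A)

card-split : ∀ {n} (B A : Fin n → Bool) → card B ≡ card (B ∩ A) + sum (λ u → χ (B u) * χ (not (A u)))
card-split B A = trans (sum-cong-≗ pointwise) (∑-distrib-+ (χ ∘ (B ∩ A)) _)
  where
  pointwise : ∀ u → χ (B u) ≡ χ (B u ∧ A u) + χ (B u) * χ (not (A u))
  pointwise u with B u | A u
  ... | true | true = refl
  ... | true | false = refl
  ... | false | _ = refl

-- Falling factorials and power inequalities.

-- The falling factorial r (r - 1) ... (r - s + 1), which is s! C(r, s). Lowering both arguments
-- together avoids truncated subtraction.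
fall : ℕ → ℕ → ℕ
fall r zero = 1
fall zero (suc s) = 0
fall (suc r) (suc s) = suc r * fall r s

-- This is the recursion that appends the last factor r - s, with the subtracted term moved to the
-- left. For s > r both falling factorials vanish.
fall-suc : ∀ r s → fall r (suc s) + s * fall r s ≡ r * fall r s
fall-suc zero zero = refl
fall-suc zero (suc s) = *-zeroʳ s
fall-suc (suc r) zero = +-identityʳ _
fall-suc (suc r) (suc s) = begin
  suc r * fall r (suc s) + suc s * (suc r * fall r s)  ≡⟨ regroup r s (fall r (suc s)) (fall r s) ⟩
  suc r * ((fall r (suc s) + s * fall r s) + fall r s) ≡⟨ cong (λ x → suc r * (x + fall r s)) (fall-suc r s) ⟩
  suc r * (r * fall r s + fall r s)                    ≡⟨ cong (suc r *_) (+-comm (r * fall r s) _) ⟩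
  suc r * (suc r * fall r s)                           ∎
  where
  open ≡-Reasoning
  regroup : ∀ r s x y → suc r * x + suc s * (suc r * y) ≡ suc r * ((x + s * y) + y)
  regroup = solve-∀

fall≡0 : ∀ {r s} → r < s → fall r s ≡ 0
fall≡0 {zero} {suc s} _ = refl
fall≡0 {suc r} {suc s} (s≤s r<s) = trans (cong (suc r *_) (fall≡0 r<s)) (*-zeroʳ (suc r))

-- The two sides differ by (y - x)(y ^ s - x ^ s), a product of nonnegative factors. These factors
-- are the witnesses `d` and `e`.
rearrangement-ordered : ∀ s {x y} → x ≤ y → y * x ^ s + x * y ^ s ≤ y * y ^ s + x * x ^ s
rearrangement-ordered s {x} {y} x≤y with m≤n⇒∃[o]m+o≡n x≤y | m≤n⇒∃[o]m+o≡n (^-monoˡ-≤ s x≤y)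
... | d , refl | e , eq rewrite sym eq = ≤-trans (m≤m+n _ (d * e)) (≤-reflexive (expand x d (x ^ s) e))
  where
  expand : ∀ x d p e → (x + d) * p + x * (p + e) + d * e ≡ (x + d) * (p + e) + x * p
  expand = solve-∀

rearrangement : ∀ s x y → y * x ^ s + x * y ^ s ≤ y * y ^ s + x * x ^ s
rearrangement s x y with ≤-total x y
... | inj₁ x≤y = rearrangement-ordered s x≤y
... | inj₂ y≤x = subst₂ _≤_ (+-comm (x * y ^ s) _) (+-comm (x * x ^ s) _) (rearrangement-ordered s y≤x)

-- AM-GM for one copy of y ^ (s + 1) and s copies of x ^ (s + 1). The induction multiplies the
-- previous case by x and adds the rearrangement inequality.
am-gm : ∀ s x y → suc s * (y * x ^ s) ≤ y ^ suc s + s * x ^ suc s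
am-gm zero x y = ≤-reflexive (base y)
  where
  base : ∀ y → 1 * (y * 1) ≡ y * 1 + 0
  base = solve-∀
-- The mixed term x y ^ (s + 1) arises both from the induction hypothesis and from the rearrangement
-- inequality, on opposite sides, so it is added first and cancelled.
am-gm (suc s) x y = +-cancelʳ-≤ (x * y ^ suc s) _ _ (begin
  suc (suc s) * (y * x ^ suc s) + x * y ^ suc s           ≡⟨ regroup s x y (x ^ s) (x * y ^ suc s) ⟩
  x * (suc s * (y * x ^ s)) + (y * x ^ suc s + x * y ^ suc s) ≤⟨ +-mono-≤ (*-monoʳ-≤ x (am-gm s x y)) (rearrangement (suc s) x y) ⟩
  x * (y ^ suc s + s * x ^ suc s) + (y ^ suc (suc s) + x * x ^ suc s) ≡⟨ refold s x (x ^ suc s) (y ^ suc s) (y ^ suc (suc s)) ⟩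
  y ^ suc (suc s) + suc s * x ^ suc (suc s) + x * y ^ suc s ∎)
  where
  open ≤-Reasoning
  regroup : ∀ s x y p z → suc (suc s) * (y * (x * p)) + z ≡ x * (suc s * (y * p)) + (y * (x * p) + z)
  regroup = solve-∀
  refold : ∀ s x p z w → x * (z + s * p) + (w + x * p) ≡ w + suc s * (x * p) + x * z
  refold = solve-∀

^-distribʳ-* : ∀ k m n → (m * n) ^ k ≡ m ^ k * n ^ k
^-distribʳ-* zero m n = refl
^-distribʳ-* (suc k) m n = trans (cong (m * n *_) (^-distribʳ-* k m n)) (e m n (m ^ k) (n ^ k))
  where e : ∀ m n x y → m * n * (x * y) ≡ m * x * (n * y)
        e = solve-∀

-- With x = a / q and y = (a + b) / (q + 1) this is the weighted AM-GM inequality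
-- (s + 1) y x ^ s ≤ y ^ (s + 1) + s x ^ (s + 1), cleared of denominators;
-- the summand s F (R K) (a A) R is added to both sides so that fall-suc applies without subtraction.
zykov-step : ∀ q s P Q a b →
  P * suc q ^ suc s ≤ fall (suc q) (suc s) * a ^ suc s →
  Q * suc q ^ s ≤ fall (suc q) s * a ^ s →
  (P + suc s * (b * Q)) * suc (suc q) ^ suc s ≤ fall (suc (suc q)) (suc s) * (a + b) ^ suc s
zykov-step q₀ s P Q a b P≤ Q≤ = *-cancelʳ-≤ _ _ (q * W) {{m*n≢0 q W {{_}} {{m^n≢0 q s}}}} (+-cancelʳ-≤ (s * F * (R * K) * (a * A) * R) _ _ (begin
  (P + suc s * (b * Q)) * (R * K) * (q * W) + s * F * (R * K) * (a * A) * R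
    ≡⟨ e1 q P Q a b s F K A W R ⟩
  (P * (q * W) + suc s * b * q * (Q * W)) * (R * K) + s * F * (R * K) * (a * A) * R
    ≤⟨ +-monoˡ-≤ _ (*-monoˡ-≤ (R * K) (+-mono-≤ P≤ (*-monoʳ-≤ (suc s * b * q) Q≤))) ⟩
  (F′ * (a * A) + suc s * b * q * (F * A)) * (R * K) + s * F * (R * K) * (a * A) * R
    ≡⟨ e2 q a b s F F′ K A ⟩
  ((F′ + s * F) + q * s * F) * (a * A) * (R * K) + suc s * b * q * (F * A) * (R * K)
    ≡⟨ cong (λ z → (z + q * s * F) * (a * A) * (R * K) + suc s * b * q * (F * A) * (R * K)) (fall-suc q s) ⟩
  (q * F + q * s * F) * (a * A) * (R * K) + suc s * b * q * (F * A) * (R * K)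
    ≡⟨ e3 q a b s F K A R ⟩
  R * F * (suc s * ((a + b) * q * (K * A)))
    ≡⟨ cong (λ z → R * F * (suc s * ((a + b) * q * z))) (^-distribʳ-* s R a) ⟨
  R * F * (suc s * ((a + b) * q * (R * a) ^ s))
    ≤⟨ *-monoʳ-≤ (R * F) (am-gm s (R * a) ((a + b) * q)) ⟩
  R * F * (((a + b) * q) ^ suc s + s * (R * a) ^ suc s)
    ≡⟨ cong₂ (λ z w → R * F * (z + s * w)) (^-distribʳ-* (suc s) (a + b) q) (^-distribʳ-* (suc s) R a) ⟩
  R * F * ((a + b) ^ suc s * (q * W) + s * (R * K * (a * A)))
    ≡⟨ e4 q a s F K A W R ((a + b) ^ suc s) ⟩
  R * F * (a + b) ^ suc s * (q * W) + s * F * (R * K) * (a * A) * R ∎))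
  where
  open ≤-Reasoning
  q R F F′ K A W : ℕ
  q = suc q₀
  R = suc q
  F = fall q s
  F′ = fall q (suc s)
  K = R ^ s
  A = a ^ s
  W = q ^ s
  e1 : ∀ q P Q a b s F K A W R →
    (P + suc s * (b * Q)) * (R * K) * (q * W) + s * F * (R * K) * (a * A) * R
    ≡ (P * (q * W) + suc s * b * q * (Q * W)) * (R * K) + s * F * (R * K) * (a * A) * R
  e1 = solve-∀
  e2 : ∀ q a b s F F′ K A →
    (F′ * (a * A) + suc s * b * q * (F * A)) * (suc q * K) + s * F * (suc q * K) * (a * A) * suc q
    ≡ ((F′ + s * F) + q * s * F) * (a * A) * (suc q * K) + suc s * b * q * (F * A) * (suc q * K)
  e2 = solve-∀
  e3 : ∀ q a b s F K A R →
    (q * F + q * s * F) * (a * A) * (R * K) + suc s * b * q * (F * A) * (R * K)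
    ≡ R * F * (suc s * ((a + b) * q * (K * A)))
  e3 = solve-∀
  e4 : ∀ q a s F K A W R M →
    R * F * (M * (q * W) + s * (R * K * (a * A))) ≡ R * F * M * (q * W) + s * F * (R * K) * (a * A) * R
  e4 = solve-∀

-- Ordered cliques inside a vertex set.

module OrderedCliques {n} (G : Graph n) where

  -- Counts s-tuples of pairwise adjacent vertices of A: after the first vertex u, the rest of the
  -- tuple is an ordered clique in the part of A adjacent to u.
  cliques : ℕ → (Fin n → Bool) → ℕ
  cliques zero A = 1
  cliques (suc s) A = sum (λ u → χ (A u) * cliques s (A ∩ G u))

  cliques-cong : ∀ s {A B} → A ≗ B → cliques s A ≡ cliques s B
  cliques-cong zero A≗B = refl
  cliques-cong (suc s) A≗B = sum-cong-≗ λ u →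
    cong₂ (λ a c → χ a * c) (A≗B u) (cliques-cong s λ w → cong (_∧ G u w) (A≗B w))

  cliques-one : ∀ A → cliques 1 A ≡ card A
  cliques-one A = sum-cong-≗ (λ u → *-identityʳ (χ (A u)))

  -- Clique-freeness is carried as a vanishing count. It passes to neighbourhoods with the index
  -- lowered by one, which drives the induction on the clique number.
  cliques≡0⇒step : ∀ s B → cliques (suc s) B ≡ 0 → ∀ u → B u ≡ true → cliques s (B ∩ G u) ≡ 0
  cliques≡0⇒step s B eq u Bu =
    trans (sym (+-identityʳ _)) (subst (λ b → χ b * cliques s (B ∩ G u) ≡ 0) Bu (sum≡0⇒ eq u))

  cliques≡0⇒suc : ∀ s B → cliques s B ≡ 0 → cliques (suc s) B ≡ 0
  cliques≡0⇒suc (suc s) B eq = sum-zero λ u → trans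
    (χ*-cong (B u) (λ Bu → cliques≡0⇒suc s (B ∩ G u) (cliques≡0⇒step s B eq u Bu))) (*-zeroʳ (χ (B u)))

  cliques≡0⇒+ : ∀ k s B → cliques s B ≡ 0 → cliques (k + s) B ≡ 0
  cliques≡0⇒+ zero s B eq = eq
  cliques≡0⇒+ (suc k) s B eq = cliques≡0⇒suc (k + s) B (cliques≡0⇒+ k s B eq)

  module _ (G-sym : ∀ i j → G i j ≡ G j i) where

    ∩-swap : ∀ (B A C : Fin n → Bool) → (B ∩ A) ∩ C ≗ (B ∩ C) ∩ A
    ∩-swap B A C i with B i | A i | C i
    ... | true | a | c = ∧-comm a c
    ... | false | _ | _ = refl

    -- A tuple not contained in A has an entry w outside A. There are s + 1 positions for w, and the
    -- other s entries form an ordered clique in `B ∩ G w`. Tuples with several entries outside A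
    -- are counted repeatedly, hence an inequality.
    cliques-split : ∀ s B A →
      cliques (suc s) B ≤ cliques (suc s) (B ∩ A)
        + suc s * sum (λ w → χ (B w) * (χ (not (A w)) * cliques s (B ∩ G w)))
    cliques-split s B A = begin
      cliques (suc s) B
        -- Tuples are sorted by whether their first entry lies in A. Those starting outside A give
        -- one copy of `outside`; `inside` bounds the others, with the remaining s positions
        -- available for w.
        ≡⟨ sum-cong-≗ (λ u → χ-split (B u) (A u) (cliques s (B ∩ G u))) ⟩
      sum (λ u → χ ((B ∩ A) u) * cliques s (B ∩ G u) + χ (B u) * (χ (not (A u)) * cliques s (B ∩ G u)))
        ≡⟨ ∑-distrib-+ {n} _ _ ⟩
      sum (λ u → χ ((B ∩ A) u) * cliques s (B ∩ G u)) + outside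
        ≤⟨ +-monoˡ-≤ outside (inside s) ⟩
      cliques (suc s) (B ∩ A) + s * outside + outside
        ≡⟨ e (cliques (suc s) (B ∩ A)) s outside ⟩
      cliques (suc s) (B ∩ A) + suc s * outside ∎
      where
      open ≤-Reasoning
      outsideAt : ℕ → ℕ
      outsideAt s = sum (λ w → χ (B w) * (χ (not (A w)) * cliques s (B ∩ G w)))
      outside : ℕ
      outside = outsideAt s
      e : ∀ c s o → c + s * o + o ≡ c + suc s * o
      e = solve-∀
      inside : ∀ s → sum (λ u → χ ((B ∩ A) u) * cliques s (B ∩ G u)) ≤ cliques (suc s) (B ∩ A) + s * outsideAt s
      inside zero = m≤m+n _ _
      inside (suc k) = begin
        sum (λ u → χ ((B ∩ A) u) * cliques (suc k) (B ∩ G u))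
          -- With the first entry u in A fixed, the splitting is applied recursively to the rest of
          -- the tuple, which lives in `B ∩ G u`.
          ≤⟨ sum-mono-≤ (λ u → *-monoʳ-≤ (χ ((B ∩ A) u)) (cliques-split k (B ∩ G u) A)) ⟩
        sum (λ u → χ ((B ∩ A) u) * (cliques (suc k) ((B ∩ G u) ∩ A) + suc k * sum (λ w → t u w)))
          ≡⟨ sum-cong-≗ (λ u → trans (dist (χ ((B ∩ A) u)) _ (suc k) _)
               (cong₂ (λ x y → χ ((B ∩ A) u) * x + suc k * y)
                 (cliques-cong (suc k) (∩-swap B (G u) A))
                 (*-distribˡ-sum (χ ((B ∩ A) u)) (t u)))) ⟩
        sum (λ u → χ ((B ∩ A) u) * cliques (suc k) ((B ∩ A) ∩ G u) + suc k * sum (λ w → χ ((B ∩ A) u) * t u w))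
          ≡⟨ ∑-distrib-+ {n} _ _ ⟩
        cliques (2 + k) (B ∩ A) + sum (λ u → suc k * sum (λ w → χ ((B ∩ A) u) * t u w))
          -- Exchanging the sums puts the outside vertex w first and u second.
          ≡⟨ cong (cliques (2 + k) (B ∩ A) +_) (trans (sym (*-distribˡ-sum {n} (suc k) _)) (cong (suc k *_) (∑-comm (λ u w → χ ((B ∩ A) u) * t u w)))) ⟩
        cliques (2 + k) (B ∩ A) + suc k * sum (λ w → sum (λ u → χ ((B ∩ A) u) * t u w))
          ≤⟨ +-monoʳ-≤ (cliques (2 + k) (B ∩ A)) (*-monoʳ-≤ (suc k) (sum-mono-≤ column)) ⟩
        cliques (2 + k) (B ∩ A) + suc k * outsideAt (suc k) ∎
        where
        t : Fin n → Fin n → ℕ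
        t u w = χ ((B ∩ G u) w) * (χ (not (A w)) * cliques k ((B ∩ G u) ∩ G w))
        dist : ∀ x c k y → x * (c + k * y) ≡ x * c + k * (x * y)
        dist = solve-∀
        swapped : ∀ w u → cliques k ((B ∩ G w) ∩ G u) ≡ cliques k ((B ∩ G u) ∩ G w)
        swapped w u = cliques-cong k (∩-swap B (G w) (G u))
        -- Symmetry of adjacency lets u and w trade places. Dropping the factor `χ (A u)` is where
        -- the overcounting enters.
        entry : ∀ w u → χ ((B ∩ A) u) * t u w ≤ χ (B w) * χ (not (A w)) * (χ ((B ∩ G w) u) * cliques k ((B ∩ G w) ∩ G u))
        entry w u rewrite G-sym w u | swapped w u
          | χ-∧ (B u) (A u) | χ-∧ (B w) (G u w) | χ-∧ (B u) (G u w) =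
          ≤-trans (≤-reflexive (shuffle (χ (B u)) (χ (A u)) (χ (B w)) (χ (G u w)) (χ (not (A w))) _))
            (χ*≤ (A u) _)
          where
          shuffle : ∀ a b c d e x → a * b * (c * d * (e * x)) ≡ b * (c * e * (a * d * x))
          shuffle = solve-∀
        column : ∀ w → sum (λ u → χ ((B ∩ A) u) * t u w) ≤ χ (B w) * (χ (not (A w)) * cliques (suc k) (B ∩ G w))
        column w = begin
          sum (λ u → χ ((B ∩ A) u) * t u w)
            ≤⟨ sum-mono-≤ (entry w) ⟩
          sum (λ u → χ (B w) * χ (not (A w)) * (χ ((B ∩ G w) u) * cliques k ((B ∩ G w) ∩ G u)))
            ≡⟨ *-distribˡ-sum {n} (χ (B w) * χ (not (A w))) _ ⟨
          χ (B w) * χ (not (A w)) * cliques (suc k) (B ∩ G w)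
            ≡⟨ *-assoc (χ (B w)) _ _ ⟩
          χ (B w) * (χ (not (A w)) * cliques (suc k) (B ∩ G w)) ∎

    -- Zykov's theorem.

    -- The bound k_s(B) ≤ C(r, s) (|B| / r) ^ s for sets B without (r + 1)-cliques, multiplied by s!
    -- and by r ^ s to stay within the natural numbers.
    ZykovBound : ℕ → Set
    ZykovBound r = ∀ s B → cliques (suc r) B ≡ 0 → cliques s B * r ^ s ≤ fall r s * card B ^ s

    -- The induction hypothesis for the neighbourhood A is used at two lengths: s + 1 for tuples
    -- inside A, and s for tuples completed by a vertex outside A.
    zykov-suc : ∀ q s → ZykovBound (suc q) → ∀ B → cliques (suc (suc (suc q))) B ≡ 0 →
      cliques (suc s) B * suc (suc q) ^ suc s ≤ fall (suc (suc q)) (suc s) * card B ^ suc s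
    zykov-suc q s ih B eq with argmax B (λ u → cliques s (B ∩ G u))
    ... | inj₁ none = ≤-trans (≤-reflexive (cong (_* suc (suc q) ^ suc s)
            (sum-zero λ u → cong (λ b → χ b * cliques s (B ∩ G u)) (none u)))) z≤n
    ... | inj₂ (v , Bv , max) = begin
      cliques (suc s) B * R
        ≤⟨ *-monoˡ-≤ R (cliques-split s B (G v)) ⟩
      (cliques (suc s) A + suc s * sum (λ w → χ (B w) * (χ (not (G v w)) * cliques s (B ∩ G w)))) * R
        ≤⟨ *-monoˡ-≤ R (+-monoʳ-≤ (cliques (suc s) A) (*-monoʳ-≤ (suc s) (begin
             sum (λ w → χ (B w) * (χ (not (G v w)) * cliques s (B ∩ G w)))
               -- By the choice of v, no w in B has more ordered s-cliques in its neighbourhood than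
               -- v has in A. The number `b` of vertices of B outside A then factors out.
               ≤⟨ sum-mono-≤ (λ w → χ*-mono (B w) (λ Bw → *-monoʳ-≤ (χ (not (G v w))) (max w Bw))) ⟩
             sum (λ w → χ (B w) * (χ (not (G v w)) * cliques s A))
               ≡⟨ sum-cong-≗ (λ w → sym (*-assoc (χ (B w)) _ _)) ⟩
             sum (λ w → χ (B w) * χ (not (G v w)) * cliques s A)
               ≡⟨ *-distribʳ-sum (cliques s A) (λ w → χ (B w) * χ (not (G v w))) ⟨
             b * cliques s A ∎))) ⟩
      (cliques (suc s) A + suc s * (b * cliques s A)) * R
        ≤⟨ zykov-step q s (cliques (suc s) A) (cliques s A) (card A) b (ih (suc s) A A-free) (ih s A A-free) ⟩
      fall (suc (suc q)) (suc s) * (card A + b) ^ suc s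
        ≡⟨ cong (λ c → fall (suc (suc q)) (suc s) * c ^ suc s) (card-split B (G v)) ⟨
      fall (suc (suc q)) (suc s) * card B ^ suc s ∎
      where
      open ≤-Reasoning
      R b : ℕ
      R = suc (suc q) ^ suc s
      b = sum (λ w → χ (B w) * χ (not (G v w)))
      A : Fin n → Bool
      A = B ∩ G v
      A-free : cliques (suc (suc q)) A ≡ 0
      A-free = cliques≡0⇒step (suc (suc q)) B eq v Bv

    zykov : ∀ r → ZykovBound r
    zykov r zero B _ = ≤-refl
    -- The factor 0 ^ (s + 1) makes the left side vanish.
    zykov zero (suc s) B _ = ≤-trans (≤-reflexive (*-zeroʳ (cliques (suc s) B))) z≤n
    -- The case r = 1 is separate because `zykov-step` divides by r - 1. Here B spans no edge, so
    -- only tuples of length at most one survive.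
    zykov (suc zero) (suc zero) B _ = ≤-reflexive (trans (*-identityʳ _) (trans (cliques-one B) (e (card B))))
      where e : ∀ c → c ≡ 1 * 1 * (c * 1)
            e = solve-∀
    zykov (suc zero) (suc (suc s)) B eq =
      ≤-trans (≤-reflexive (cong (_* 1 ^ (2 + s)) (subst (λ k → cliques k B ≡ 0) (+-comm s 2) (cliques≡0⇒+ s 2 B eq)))) z≤n
    zykov (suc (suc q)) (suc s) B eq = zykov-suc q s (zykov (suc q)) B eq

-- Boolean tests as propositions, and sums over subsets.

true-⇔⇒≡ : ∀ {a b : Bool} → (a ≡ true → b ≡ true) → (b ≡ true → a ≡ true) → a ≡ b
true-⇔⇒≡ {true} {b} f g = sym (f refl)
true-⇔⇒≡ {false} {true} f g = g refl
true-⇔⇒≡ {false} {false} f g = refl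

∧-true⁻ : ∀ a b → a ∧ b ≡ true → a ≡ true × b ≡ true
∧-true⁻ true b eq = refl , eq

∧-true⁺ : ∀ {a b} → a ≡ true → b ≡ true → a ∧ b ≡ true
∧-true⁺ refl refl = refl

≡ᵇ-true⁻ : ∀ m n → (m ≡ᵇ n) ≡ true → m ≡ n
≡ᵇ-true⁻ m n eq = ≡ᵇ⇒≡ m n (from T-≡ eq)

≡ᵇ-true⁺ : ∀ m n → m ≡ n → (m ≡ᵇ n) ≡ true
≡ᵇ-true⁺ m n eq = to T-≡ (≡⇒≡ᵇ m n eq)

allᵇ-tabulate : ∀ {A : Set} {n} (p : A → Bool) (f : Fin n → A) → allᵇ p (tabulate f) ≡ true ⇔ (∀ i → p (f i) ≡ true)
allᵇ-tabulate {n = zero} p f = mk⇔ (λ _ ()) (λ _ → refl)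
allᵇ-tabulate {n = suc n} p f = mk⇔
  (λ eq → λ { zero → proj₁ (∧-true⁻ _ _ eq) ; (suc i) → to (allᵇ-tabulate p (f ∘ suc)) (proj₂ (∧-true⁻ (p (f zero)) _ eq)) i })
  (λ all → ∧-true⁺ (all zero) (from (allᵇ-tabulate p (f ∘ suc)) (all ∘ suc)))

length-filterᵇ-tabulate : ∀ {A : Set} {n} (p : A → Bool) (f : Fin n → A) →
  length (filterᵇ p (tabulate f)) ≡ sum (χ ∘ p ∘ f)
length-filterᵇ-tabulate {n = zero} p f = refl
length-filterᵇ-tabulate {n = suc n} p f with p (f zero)
... | true = cong suc (length-filterᵇ-tabulate p (f ∘ suc))
... | false = length-filterᵇ-tabulate p (f ∘ suc)

degree≡card : ∀ {n} (G : Graph n) v → degree G v ≡ card (G v)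
degree≡card G v = length-filterᵇ-tabulate (G v) id

length-filterᵇ-map : ∀ {A B : Set} (p : B → Bool) (f : A → B) xs →
  length (filterᵇ p (map f xs)) ≡ length (filterᵇ (p ∘ f) xs)
length-filterᵇ-map p f [] = refl
length-filterᵇ-map p f (x ∷ xs) with p (f x)
... | true = cong suc (length-filterᵇ-map p f xs)
... | false = length-filterᵇ-map p f xs

-- The recursion mirrors `allSubsets`, so the list length defining `kt` becomes a sum that can be
-- exchanged with sums over vertices.
sumSubsets : ∀ {n} → (Subset n → ℕ) → ℕ
sumSubsets {zero} F = F []
sumSubsets {suc n} F = sumSubsets (F ∘ (true ∷_)) + sumSubsets (F ∘ (false ∷_))

length-filterᵇ-allSubsets : ∀ n (p : Subset n → Bool) → length (filterᵇ p (allSubsets n)) ≡ sumSubsets (χ ∘ p)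
length-filterᵇ-allSubsets zero p with p []
... | true = refl
... | false = refl
length-filterᵇ-allSubsets (suc n) p = begin
  length (filterᵇ p (map (true ∷_) (allSubsets n) ++ map (false ∷_) (allSubsets n)))
    ≡⟨ cong length (filter-++ (T? ∘ p) (map (true ∷_) (allSubsets n)) _) ⟩
  length (filterᵇ p (map (true ∷_) (allSubsets n)) ++ filterᵇ p (map (false ∷_) (allSubsets n)))
    ≡⟨ length-++ (filterᵇ p (map (true ∷_) (allSubsets n))) ⟩
  length (filterᵇ p (map (true ∷_) (allSubsets n))) + length (filterᵇ p (map (false ∷_) (allSubsets n)))
    ≡⟨ cong₂ _+_ (half true) (half false) ⟩
  sumSubsets (χ ∘ p) ∎
  where
  open ≡-Reasoning
  half : ∀ b → length (filterᵇ p (map (b ∷_) (allSubsets n))) ≡ sumSubsets (χ ∘ p ∘ (b ∷_))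
  half b = trans (length-filterᵇ-map p (b ∷_) (allSubsets n)) (length-filterᵇ-allSubsets n (p ∘ (b ∷_)))

sumSubsets-cong : ∀ {n} {F H : Subset n → ℕ} → F ≗ H → sumSubsets F ≡ sumSubsets H
sumSubsets-cong {zero} F≗H = F≗H []
sumSubsets-cong {suc n} F≗H =
  cong₂ _+_ (sumSubsets-cong (F≗H ∘ (true ∷_))) (sumSubsets-cong (F≗H ∘ (false ∷_)))

sumSubsets-zero : ∀ n → sumSubsets {n} (λ _ → 0) ≡ 0
sumSubsets-zero zero = refl
sumSubsets-zero (suc n) = cong₂ _+_ (sumSubsets-zero n) (sumSubsets-zero n)

sumSubsets≡0⇒ : ∀ {n} (F : Subset n → ℕ) → sumSubsets F ≡ 0 → ∀ S → F S ≡ 0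
sumSubsets≡0⇒ F eq [] = eq
sumSubsets≡0⇒ F eq (true ∷ S) = sumSubsets≡0⇒ (F ∘ (true ∷_)) (m+n≡0⇒m≡0 _ eq) S
sumSubsets≡0⇒ F eq (false ∷ S) = sumSubsets≡0⇒ (F ∘ (false ∷_)) (m+n≡0⇒n≡0 (sumSubsets (F ∘ (true ∷_))) eq) S

*-distribˡ-sumSubsets : ∀ {n} k (F : Subset n → ℕ) → k * sumSubsets F ≡ sumSubsets (λ S → k * F S)
*-distribˡ-sumSubsets {zero} k F = refl
*-distribˡ-sumSubsets {suc n} k F = trans (*-distribˡ-+ k _ _)
  (cong₂ _+_ (*-distribˡ-sumSubsets k (F ∘ (true ∷_))) (*-distribˡ-sumSubsets k (F ∘ (false ∷_))))

sumSubsets-sum-comm : ∀ {n m} (F : Subset n → Fin m → ℕ) →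
  sumSubsets (λ S → sum (F S)) ≡ sum (λ u → sumSubsets (λ S → F S u))
sumSubsets-sum-comm {zero} F = refl
sumSubsets-sum-comm {suc n} {m} F = trans
  (cong₂ _+_ (sumSubsets-sum-comm (F ∘ (true ∷_))) (sumSubsets-sum-comm (F ∘ (false ∷_))))
  (sym (∑-distrib-+ {m} _ _))

sumSubsets-size-zero : ∀ {n} (p : Subset n → Bool) →
  sumSubsets (λ S → χ ((∣ S ∣ ≡ᵇ 0) ∧ p S)) ≡ χ (p ⊥)
sumSubsets-size-zero {zero} p = refl
sumSubsets-size-zero {suc n} p =
  cong₂ _+_ (sumSubsets-zero n) (sumSubsets-size-zero (p ∘ (false ∷_)))

-- Adding u is a bijection from the subsets avoiding u onto the subsets containing u.
sumSubsets-insert : ∀ {n} (F : Subset n → ℕ) u →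
  sumSubsets (λ S → χ (lookup S u) * F S) ≡ sumSubsets (λ S → χ (not (lookup S u)) * F (S [ u ]≔ true))
sumSubsets-insert {suc n} F zero = +-comm _ (sumSubsets {n} (λ _ → 0))
sumSubsets-insert F (suc u) = cong₂ _+_ (sumSubsets-insert (F ∘ (true ∷_)) u) (sumSubsets-insert (F ∘ (false ∷_)) u)

∣S∣≡sum : ∀ {n} (S : Subset n) → ∣ S ∣ ≡ sum (χ ∘ lookup S)
∣S∣≡sum [] = refl
∣S∣≡sum (true ∷ S) = cong suc (∣S∣≡sum S)
∣S∣≡sum (false ∷ S) = ∣S∣≡sum S

∣S∪u∣ : ∀ {n} (S : Subset n) u → lookup S u ≡ false → ∣ S [ u ]≔ true ∣ ≡ suc ∣ S ∣
∣S∪u∣ (false ∷ S) zero _ = refl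
∣S∪u∣ (true ∷ S) (suc u) eq = cong suc (∣S∪u∣ S u eq)
∣S∪u∣ (false ∷ S) (suc u) eq = ∣S∪u∣ S u eq

Clique : ∀ {n} → Graph n → Subset n → Set
Clique G S = ∀ i j → lookup S i ≡ true → lookup S j ≡ true → i ≢ j → G i j ≡ true

isCliqueᵇ⇔ : ∀ {n} (G : Graph n) S → isCliqueᵇ G S ≡ true ⇔ Clique G S
isCliqueᵇ⇔ {n} G S = mk⇔
  (λ eq i j → to (edge i j) (to (allᵇ-tabulate _ id) (to (allᵇ-tabulate _ id) eq i) j))
  (λ cl → from (allᵇ-tabulate _ id) λ i → from (allᵇ-tabulate _ id) λ j → from (edge i j) (cl i j))
  where
  edge : ∀ i j → (not (lookup S i ∧ lookup S j ∧ not (eqFin i j)) ∨ G i j ≡ true) ⇔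
    (lookup S i ≡ true → lookup S j ≡ true → i ≢ j → G i j ≡ true)
  edge i j with lookup S i | lookup S j | eqFin i j in eq | G i j
  ... | _ | _ | _ | true = mk⇔ (λ _ _ _ _ → refl) (λ { _ → ∨-true _ })
    where
    ∨-true : ∀ b → b ∨ true ≡ true
    ∨-true true = refl
    ∨-true false = refl
  ... | false | _ | _ | false = mk⇔ (λ _ ()) (λ _ → refl)
  ... | true | false | _ | false = mk⇔ (λ _ _ ()) (λ _ → refl)
  ... | true | true | true | false = mk⇔ (λ _ _ _ i≢j → ⊥-elim (i≢j (toℕ-injective (≡ᵇ-true⁻ (toℕ i) (toℕ j) eq)))) (λ _ → refl)
  ... | true | true | false | false = mk⇔ (λ ()) (λ f → f refl refl λ i≡j →
          true≢false (trans (sym (≡ᵇ-true⁺ (toℕ i) (toℕ j) (cong toℕ i≡j))) eq))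

subsetᵇ : ∀ {n} → (Fin n → Bool) → Subset n → Bool
subsetᵇ {n} A S = allᵇ (λ i → not (lookup S i) ∨ A i) (allFin n)

subsetᵇ⇔ : ∀ {n} (A : Fin n → Bool) S → subsetᵇ A S ≡ true ⇔ (∀ i → lookup S i ≡ true → A i ≡ true)
subsetᵇ⇔ A S = mk⇔
  (λ eq i → to (imp i) (to (allᵇ-tabulate _ id) eq i))
  (λ sub → from (allᵇ-tabulate _ id) λ i → from (imp i) (sub i))
  where
  imp : ∀ i → (not (lookup S i) ∨ A i ≡ true) ⇔ (lookup S i ≡ true → A i ≡ true)
  imp i with lookup S i
  ... | true = mk⇔ (λ eq _ → eq) (λ f → f refl)
  ... | false = mk⇔ (λ _ ()) (λ _ → refl)

-- Ordered tuples versus cliques as vertex sets.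

module CountCliques {n} (G : Graph n) (G-simple : Simple G) where

  open OrderedCliques G

  G-sym = proj₁ G-simple
  G-irrefl = proj₂ G-simple

  cliqueInᵇ : ℕ → (Fin n → Bool) → Subset n → Bool
  cliqueInᵇ s A S = (∣ S ∣ ≡ᵇ s) ∧ (isCliqueᵇ G S ∧ subsetᵇ A S)

  CliqueIn : ℕ → (Fin n → Bool) → Subset n → Set
  CliqueIn s A S = ∣ S ∣ ≡ s × Clique G S × (∀ i → lookup S i ≡ true → A i ≡ true)

  cliqueInᵇ⇔ : ∀ s A S → cliqueInᵇ s A S ≡ true ⇔ CliqueIn s A S
  cliqueInᵇ⇔ s A S = mk⇔
    (λ eq → let sz , rest = ∧-true⁻ (∣ S ∣ ≡ᵇ s) _ eq
                cl , sub = ∧-true⁻ (isCliqueᵇ G S) _ rest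
            in ≡ᵇ-true⁻ _ s sz , to (isCliqueᵇ⇔ G S) cl , to (subsetᵇ⇔ A S) sub)
    (λ (sz , cl , sub) → ∧-true⁺ (≡ᵇ-true⁺ _ s sz) (∧-true⁺ (from (isCliqueᵇ⇔ G S) cl) (from (subsetᵇ⇔ A S) sub)))

  lookup-insert⁺ : ∀ (S : Subset n) u i → lookup S i ≡ true → lookup (S [ u ]≔ true) i ≡ true
  lookup-insert⁺ S u i Si with i ≟ꟳ u
  ... | yes refl = lookup∘updateAt u S
  ... | no i≢u = trans (lookup∘updateAt′ i u i≢u S) Si

  -- The set-level counterpart of the recursion defining `cliques`: deleting u from a clique leaves
  -- a clique among the neighbours of u, and conversely.
  cliqueIn-insert : ∀ s A S u →
    not (lookup S u) ∧ cliqueInᵇ (suc s) A (S [ u ]≔ true) ≡ A u ∧ cliqueInᵇ s (A ∩ G u) S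
  cliqueIn-insert s A S u = true-⇔⇒≡ fwd bwd
    where
    S⁺ : Subset n
    S⁺ = S [ u ]≔ true
    u∈S⁺ : lookup S⁺ u ≡ true
    u∈S⁺ = lookup∘updateAt u S
    not-true⇒false : ∀ b → not b ≡ true → b ≡ false
    not-true⇒false false _ = refl
    fwd : not (lookup S u) ∧ cliqueInᵇ (suc s) A S⁺ ≡ true → A u ∧ cliqueInᵇ s (A ∩ G u) S ≡ true
    fwd eq = ∧-true⁺ (sub u u∈S⁺) (from (cliqueInᵇ⇔ s (A ∩ G u) S)
      ( suc-injective (trans (sym (∣S∪u∣ S u u∉S)) sz)
      , (λ i j Si Sj → cl i j (lookup-insert⁺ S u i Si) (lookup-insert⁺ S u j Sj))
      , λ i Si → ∧-true⁺ (sub i (lookup-insert⁺ S u i Si))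
          (cl u i u∈S⁺ (lookup-insert⁺ S u i Si) λ { refl → true≢false (trans (sym Si) u∉S) })))
      where
      parts = ∧-true⁻ (not (lookup S u)) _ eq
      u∉S = not-true⇒false _ (proj₁ parts)
      spec = to (cliqueInᵇ⇔ (suc s) A S⁺) (proj₂ parts)
      sz = proj₁ spec
      cl = proj₁ (proj₂ spec)
      sub = proj₂ (proj₂ spec)
    bwd : A u ∧ cliqueInᵇ s (A ∩ G u) S ≡ true → not (lookup S u) ∧ cliqueInᵇ (suc s) A S⁺ ≡ true
    bwd eq = ∧-true⁺ (cong not u∉S) (from (cliqueInᵇ⇔ (suc s) A S⁺) (trans (∣S∪u∣ S u u∉S) (cong suc sz) , cl⁺ , sub⁺))
      where
      parts = ∧-true⁻ (A u) _ eq
      spec = to (cliqueInᵇ⇔ s (A ∩ G u) S) (proj₂ parts)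
      sz = proj₁ spec
      cl = proj₁ (proj₂ spec)
      sub : ∀ i → lookup S i ≡ true → A i ≡ true × G u i ≡ true
      sub i Si = ∧-true⁻ _ _ (proj₂ (proj₂ spec) i Si)
      u∉S : lookup S u ≡ false
      -- Every member of S is a neighbour of u, and there are no loops.
      u∉S with lookup S u in Su
      ... | false = refl
      ... | true = ⊥-elim (true≢false (trans (sym (proj₂ (sub u Su))) (G-irrefl u)))
      old : ∀ i → i ≢ u → lookup S⁺ i ≡ true → lookup S i ≡ true
      old i i≢u eq = trans (sym (lookup∘updateAt′ i u i≢u S)) eq
      sub⁺ : ∀ i → lookup S⁺ i ≡ true → A i ≡ true
      sub⁺ i S⁺i with i ≟ꟳ u
      ... | yes refl = proj₁ parts
      ... | no i≢u = proj₁ (sub i (old i i≢u S⁺i))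
      cl⁺ : Clique G S⁺
      cl⁺ i j S⁺i S⁺j i≢j with i ≟ꟳ u | j ≟ꟳ u
      ... | yes refl | yes refl = ⊥-elim (i≢j refl)
      ... | yes refl | no j≢u = proj₂ (sub j (old j j≢u S⁺j))
      ... | no i≢u | yes refl = trans (G-sym i u) (proj₂ (sub i (old i i≢u S⁺i)))
      ... | no i≢u | no j≢u = cl i j (old i i≢u S⁺i) (old j j≢u S⁺j) i≢j

  -- Double counting of the pairs (S , u) with u in the (s + 1)-clique S.
  cliques≡! : ∀ s A → cliques s A ≡ s ! * sumSubsets (χ ∘ cliqueInᵇ s A)
  cliques≡! zero A = sym (trans (+-identityʳ _) (trans
    (sumSubsets-size-zero (λ S → isCliqueᵇ G S ∧ subsetᵇ A S))
    (cong χ (∧-true⁺ (from (isCliqueᵇ⇔ G ⊥) λ i _ i∈⊥ → ⊥-elim (∉⊥ i i∈⊥))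
                     (from (subsetᵇ⇔ A ⊥) λ i i∈⊥ → ⊥-elim (∉⊥ i i∈⊥))))))
    where
    ∉⊥ : ∀ i → lookup {n = n} ⊥ i ≢ true
    ∉⊥ i i∈⊥ = true≢false (trans (sym i∈⊥) (lookup-replicate i false))
  cliques≡! (suc s) A = begin
    sum (λ u → χ (A u) * cliques s (A ∩ G u))
      ≡⟨ sum-cong-≗ (λ u → trans (cong (χ (A u) *_) (cliques≡! s (A ∩ G u))) (x*y*z (χ (A u)) (s !) _)) ⟩
    sum (λ u → s ! * (χ (A u) * sumSubsets (χ ∘ cliqueInᵇ s (A ∩ G u))))
      ≡⟨ *-distribˡ-sum {n} (s !) _ ⟨
    s ! * sum (λ u → χ (A u) * sumSubsets (χ ∘ cliqueInᵇ s (A ∩ G u)))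
      ≡⟨ cong (s ! *_) (sum-cong-≗ at) ⟩
    s ! * sum (λ u → sumSubsets (λ S → χ (lookup S u) * χ (K S)))
      ≡⟨ cong (s ! *_) (sumSubsets-sum-comm (λ S u → χ (lookup S u) * χ (K S))) ⟨
    s ! * sumSubsets (λ S → sum (λ u → χ (lookup S u) * χ (K S)))
      ≡⟨ cong (s ! *_) (sumSubsets-cong size) ⟩
    s ! * sumSubsets (λ S → suc s * χ (K S))
      ≡⟨ cong (s ! *_) (*-distribˡ-sumSubsets (suc s) (χ ∘ K)) ⟨
    s ! * (suc s * sumSubsets (χ ∘ K))
      ≡⟨ x*y*z (s !) (suc s) _ ⟩
    suc s * (s ! * sumSubsets (χ ∘ K))
      ≡⟨ *-assoc (suc s) (s !) _ ⟨
    (suc s) ! * sumSubsets (χ ∘ K) ∎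
    where
    open ≡-Reasoning
    K : Subset n → Bool
    K = cliqueInᵇ (suc s) A
    x*y*z : ∀ x y z → x * (y * z) ≡ y * (x * z)
    x*y*z = solve-∀
    at : ∀ u → χ (A u) * sumSubsets (χ ∘ cliqueInᵇ s (A ∩ G u)) ≡ sumSubsets (λ S → χ (lookup S u) * χ (K S))
    at u = begin
      χ (A u) * sumSubsets (χ ∘ cliqueInᵇ s (A ∩ G u))
        ≡⟨ *-distribˡ-sumSubsets {n} (χ (A u)) _ ⟩
      sumSubsets (λ S → χ (A u) * χ (cliqueInᵇ s (A ∩ G u) S))
        ≡⟨ sumSubsets-cong (λ S → trans (sym (χ-∧ (A u) _)) (trans (cong χ (sym (cliqueIn-insert s A S u))) (χ-∧ (not (lookup S u)) _))) ⟩
      sumSubsets (λ S → χ (not (lookup S u)) * χ (K (S [ u ]≔ true)))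
        ≡⟨ sumSubsets-insert (χ ∘ K) u ⟨
      sumSubsets (λ S → χ (lookup S u) * χ (K S)) ∎
    size : ∀ S → sum (λ u → χ (lookup S u) * χ (K S)) ≡ suc s * χ (K S)
    size S with K S in eq
    ... | true = trans (sym (*-distribʳ-sum 1 (χ ∘ lookup S))) (cong (_* 1)
            (trans (sym (∣S∣≡sum S)) (proj₁ (to (cliqueInᵇ⇔ (suc s) A S) eq))))
    ... | false = trans (sum-zero (λ u → *-zeroʳ (χ (lookup S u)))) (sym (*-zeroʳ (suc s)))

  everything : Fin n → Bool
  everything _ = true

  cliques≡!*kt : ∀ s → cliques s everything ≡ s ! * kt s G
  cliques≡!*kt s = trans (cliques≡! s everything) (cong (s ! *_) (trans
    (sumSubsets-cong (λ S → cong (λ b → χ ((∣ S ∣ ≡ᵇ s) ∧ b)) (true-⇔⇒≡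
      (λ eq → proj₁ (∧-true⁻ (isCliqueᵇ G S) _ eq))
      (λ eq → ∧-true⁺ eq (from (subsetᵇ⇔ everything S) λ _ _ → refl)))))
    (sym (length-filterᵇ-allSubsets n _))))

  -- S itself contributes to the count. This turns a vanishing count into an upper bound on the
  -- clique number, as needed for the Turán graph.
  Clique⇒cliques≢0 : ∀ S → isCliqueᵇ G S ≡ true → cliques ∣ S ∣ everything ≢ 0
  Clique⇒cliques≢0 S cl eq with sumSubsets≡0⇒ (χ ∘ cliqueInᵇ ∣ S ∣ everything)
    (m*n≡0⇒m≡0 _ (∣ S ∣ !) {{∣ S ∣ !≢0}} (trans (*-comm _ (∣ S ∣ !)) (trans (sym (cliques≡! ∣ S ∣ everything)) eq))) S
  ... | χ≡0 rewrite from (cliqueInᵇ⇔ ∣ S ∣ everything S) (refl , to (isCliqueᵇ⇔ G S) cl , λ _ _ → refl) with () ← χ≡0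

  -- Converts the clique number condition of the class into the vanishing count that Zykov's theorem
  -- assumes.
  ¬Clique⇒cliques≡0 : ∀ s → (∀ S → isCliqueᵇ G S ≡ true → ∣ S ∣ ≢ s) → cliques s everything ≡ 0
  ¬Clique⇒cliques≡0 s none = trans (cliques≡! s everything) (trans (cong (s ! *_)
    (trans (sumSubsets-cong λ S → absent S) (sumSubsets-zero n))) (*-zeroʳ (s !)))
    where
    absent : ∀ S → χ (cliqueInᵇ s everything S) ≡ 0
    absent S with cliqueInᵇ s everything S in eq
    ... | false = refl
    ... | true = let sz , cl , _ = to (cliqueInᵇ⇔ s everything S) eq in ⊥-elim (none S (from (isCliqueᵇ⇔ G S) cl) sz)

-- Clique counts of the balanced Turán graph.

sum-toℕ-+ : ∀ m n (f : ℕ → ℕ) →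
  sum {m + n} (f ∘ toℕ) ≡ sum {m} (f ∘ toℕ) + sum {n} (λ i → f (m + toℕ i))
sum-toℕ-+ zero n f = refl
sum-toℕ-+ (suc m) n f = trans (cong (f 0 +_) (sum-toℕ-+ m n (f ∘ suc))) (sym (+-assoc (f 0) _ _))

sum-indicator : ∀ {n c} → c < n → sum {n} (λ i → χ (toℕ i ≡ᵇ c)) ≡ 1
sum-indicator {suc n} {zero} _ = cong suc (sum-zero {n} λ _ → refl)
sum-indicator {suc n} {suc c} (s≤s c<n) = sum-indicator c<n

-- The first r + 1 integers meet each residue once, and shifting by r + 1 preserves residues, so
-- each of the d blocks contributes one.
residue-class : ∀ r d {c} → c < suc r → sum {d * suc r} (λ i → χ (toℕ i % suc r ≡ᵇ c)) ≡ d
residue-class r zero _ = refl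
residue-class r (suc d) {c} c<r = begin
  sum {suc r + d * suc r} (f ∘ toℕ)
    ≡⟨ sum-toℕ-+ (suc r) (d * suc r) f ⟩
  sum {suc r} (f ∘ toℕ) + sum {d * suc r} (λ i → f (suc r + toℕ i))
    ≡⟨ cong₂ _+_
         (trans (sum-cong-≗ {suc r} λ i → cong (λ m → χ (m ≡ᵇ c)) (m<n⇒m%n≡m (toℕ<n i))) (sum-indicator c<r))
         (trans (sum-cong-≗ {d * suc r} λ i → cong (λ m → χ (m ≡ᵇ c))
           (trans (cong (_% suc r) (+-comm (suc r) (toℕ i))) ([m+n]%n≡m%n (toℕ i) (suc r))))
           (residue-class r d c<r)) ⟩
  suc d ∎
  where
  open ≡-Reasoning
  f : ℕ → ℕ
  f m = χ (m % suc r ≡ᵇ c)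

≡ᵇ-sym : ∀ m n → (m ≡ᵇ n) ≡ (n ≡ᵇ m)
≡ᵇ-sym m n = true-⇔⇒≡ (λ eq → ≡ᵇ-true⁺ n m (sym (≡ᵇ-true⁻ m n eq))) (λ eq → ≡ᵇ-true⁺ m n (sym (≡ᵇ-true⁻ n m eq)))

module BalancedTuran (r d : ℕ) where

  N : ℕ
  N = d * suc r

  Tur : Graph N
  Tur = turan (suc r) N

  Tur-simple : Simple Tur
  Tur-simple = (λ i j → cong not (≡ᵇ-sym (toℕ i % suc r) _)) , (λ i → cong not (≡ᵇ-true⁺ (toℕ i % suc r) _ refl))

  open OrderedCliques Tur
  open CountCliques Tur Tur-simple

  -- The invariant of the clique count: together with `card A ≡ k * d` it says that A consists of k
  -- whole parts when d is positive.
  UnionOfParts : (Fin N → Bool) → Set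
  UnionOfParts A = ∀ i j → toℕ i % suc r ≡ toℕ j % suc r → A i ≡ A j

  ∩-neighbours-parts : ∀ {A} → UnionOfParts A → ∀ u → UnionOfParts (A ∩ Tur u)
  ∩-neighbours-parts A-parts u i j i≡j = cong₂ _∧_ (A-parts i j i≡j) (cong (λ m → not (toℕ u % suc r ≡ᵇ m)) i≡j)

  card-∩-neighbours : ∀ k {A} → UnionOfParts A → card A ≡ suc k * d → ∀ u → A u ≡ true → card (A ∩ Tur u) ≡ k * d
  card-∩-neighbours k {A} A-parts card≡ u Au = +-cancelʳ-≡ d _ _ (begin
    card (A ∩ Tur u) + d
      ≡⟨ cong (card (A ∩ Tur u) +_) (residue-class r d (m%n<n (toℕ u) (suc r))) ⟨
    card (A ∩ Tur u) + sum {N} (λ i → χ (toℕ i % suc r ≡ᵇ toℕ u % suc r))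
      -- The non-neighbours of u form its own part, which lies entirely in A because A contains u
      -- and is a union of parts.
      ≡⟨ cong (card (A ∩ Tur u) +_) (sum-cong-≗ {N} part) ⟩
    card (A ∩ Tur u) + sum (λ i → χ (A i) * χ (not (Tur u i)))
      ≡⟨ card-split A (Tur u) ⟨
    card A
      ≡⟨ card≡ ⟩
    d + k * d
      ≡⟨ +-comm d (k * d) ⟩
    k * d + d ∎)
    where
    open ≡-Reasoning
    part : ∀ i → χ (toℕ i % suc r ≡ᵇ toℕ u % suc r) ≡ χ (A i) * χ (not (Tur u i))
    part i rewrite ≡ᵇ-sym (toℕ i % suc r) (toℕ u % suc r) with toℕ u % suc r ≡ᵇ toℕ i % suc r in eq
    ... | false = sym (*-zeroʳ (χ (A i)))
    ... | true rewrite sym (A-parts u i (≡ᵇ-true⁻ (toℕ u % suc r) _ eq)) | Au = refl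

  -- The first entry can be chosen in k d ways and uses up its part, leaving k - 1 whole parts for
  -- the others.
  cliques-parts : ∀ s k A → UnionOfParts A → card A ≡ k * d → cliques s A ≡ fall k s * d ^ s
  cliques-parts zero k A _ _ = refl
  cliques-parts (suc s) zero A _ card≡0 = sum-zero λ u → cong (_* cliques s (A ∩ Tur u)) (sum≡0⇒ card≡0 u)
  cliques-parts (suc s) (suc k) A A-parts card≡ = begin
    sum (λ u → χ (A u) * cliques s (A ∩ Tur u))
      ≡⟨ sum-cong-≗ (λ u → χ*-cong (A u) λ Au →
           cliques-parts s k (A ∩ Tur u) (∩-neighbours-parts A-parts u) (card-∩-neighbours k A-parts card≡ u Au)) ⟩
    sum (λ u → χ (A u) * (fall k s * d ^ s))
      ≡⟨ *-distribʳ-sum (fall k s * d ^ s) (χ ∘ A) ⟨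
    card A * (fall k s * d ^ s)
      ≡⟨ cong (_* (fall k s * d ^ s)) card≡ ⟩
    suc k * d * (fall k s * d ^ s)
      ≡⟨ e k d (fall k s) (d ^ s) ⟩
    fall (suc k) (suc s) * d ^ suc s ∎
    where
    open ≡-Reasoning
    e : ∀ k d x y → suc k * d * (x * y) ≡ suc k * x * (d * y)
    e = solve-∀

  card-everything : card everything ≡ suc r * d
  card-everything = trans (sum-const N 1) (trans (*-identityʳ N) (*-comm d (suc r)))

  cliques-Tur : ∀ s → cliques s everything ≡ fall (suc r) s * d ^ s
  cliques-Tur s = cliques-parts s (suc r) everything (λ _ _ _ → refl) card-everything

  Tur-inClass : InClass (d * r) (suc r) Tur
  Tur-inClass = Tur-simple
    , (λ v → ≤-reflexive (trans (degree≡card Tur v)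
        (trans (card-∩-neighbours r {everything} (λ _ _ _ → refl) card-everything v refl) (*-comm r d))))
    -- A clique larger than the number of parts would have a nonzero count, whereas the falling
    -- factorial in `cliques-Tur` is then zero.
    , λ S cl → ≮⇒≥ λ ω<∣S∣ → Clique⇒cliques≢0 S cl
        (trans (cliques-Tur ∣ S ∣) (cong (_* d ^ ∣ S ∣) (fall≡0 ω<∣S∣)))

  !*kt-Tur : ∀ s → s ! * kt s Tur ≡ fall (suc r) s * d ^ s
  !*kt-Tur s = trans (sym (cliques≡!*kt s)) (cliques-Tur s)

-- The upper bound for the class and the value of the limit density.

module _ {n r d : ℕ} (G : Graph n) (G∈ : InClass (d * suc r) (suc (suc r)) G) where

  open OrderedCliques G
  open CountCliques G (proj₁ G∈)

  -- Zykov's theorem is applied with r + 1 = ω - 1. Since Δ = d (r + 1), the denominator (r + 1) ^ s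
  -- cancels against Δ ^ s.
  cliques-neighbourhood : ∀ s v → cliques s (G v) ≤ fall (suc r) s * d ^ s
  cliques-neighbourhood s v = *-cancelʳ-≤ _ _ (suc r ^ s) {{m^n≢0 (suc r) s}} (begin
    cliques s (G v) * suc r ^ s
      -- The set `everything ∩ G v` reduces to `G v`, so the absence of (ω + 1)-cliques in the graph
      -- gives the absence of ω-cliques here.
      ≤⟨ zykov G-sym (suc r) s (G v) (cliques≡0⇒step (suc (suc r)) everything free v refl) ⟩
    fall (suc r) s * card (G v) ^ s
      ≤⟨ *-monoʳ-≤ (fall (suc r) s) (^-monoˡ-≤ s (≤-trans (≤-reflexive (sym (degree≡card G v))) (proj₁ (proj₂ G∈) v))) ⟩
    fall (suc r) s * (d * suc r) ^ s
      ≡⟨ cong (fall (suc r) s *_) (^-distribʳ-* s d (suc r)) ⟩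
    fall (suc r) s * (d ^ s * suc r ^ s)
      ≡⟨ *-assoc (fall (suc r) s) _ _ ⟨
    fall (suc r) s * d ^ s * suc r ^ s ∎)
    where
    open ≤-Reasoning
    free : cliques (suc (suc (suc r))) everything ≡ 0
    free = ¬Clique⇒cliques≡0 _ λ S cl ∣S∣≡ → 1+n≰n (subst (_≤ suc (suc r)) ∣S∣≡ (proj₂ (proj₂ G∈) S cl))

  !*kt-bound : ∀ s → (suc s) ! * kt (suc s) G ≤ n * (fall (suc r) s * d ^ s)
  !*kt-bound s = begin
    (suc s) ! * kt (suc s) G          ≡⟨ cliques≡!*kt (suc s) ⟨
    sum (λ v → 1 * cliques s (G v))   ≤⟨ sum-mono-≤ (λ v → ≤-trans (χ*≤ true _) (cliques-neighbourhood s v)) ⟩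
    sum {n} (λ _ → fall (suc r) s * d ^ s) ≡⟨ sum-const n _ ⟩
    n * (fall (suc r) s * d ^ s)      ∎
    where open ≤-Reasoning

density-bound : ∀ {n} r d s (G : Graph n) → InClass (d * suc r) (suc (suc r)) G →
  kt (suc s) G * (d * suc (suc r)) ≤ kt (suc s) (turan (suc (suc r)) (d * suc (suc r))) * n
density-bound {n} r d s G G∈ = *-cancelˡ-≤ ((suc s) !) {{(suc s) !≢0}} (begin
  (suc s) ! * (kt (suc s) G * N)                 ≡⟨ *-assoc ((suc s) !) _ _ ⟨
  (suc s) ! * kt (suc s) G * N                   ≤⟨ *-monoˡ-≤ N (!*kt-bound G G∈ s) ⟩
  n * (fall (suc r) s * d ^ s) * N               ≡⟨ e n (fall (suc r) s) (d ^ s) d (suc (suc r)) ⟩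
  -- The leading factor ω = r + 2 of N completes the falling factorial, so the bound is exactly the
  -- Turán count.
  suc (suc r) * fall (suc r) s * (d * d ^ s) * n ≡⟨ cong (_* n) (!*kt-Tur (suc s)) ⟨
  (suc s) ! * kt (suc s) Tur * n                 ≡⟨ *-assoc ((suc s) !) _ _ ⟩
  (suc s) ! * (kt (suc s) Tur * n)               ∎)
  where
  open ≤-Reasoning
  open BalancedTuran (suc r) d
  e : ∀ n x y d w → n * (x * y) * (d * w) ≡ w * x * (d * y) * n
  e = solve-∀

-- N is a variable with an equation so that it can be instantiated with Δ + Δ / (ω - 1). For
-- minimality, any upper bound is tested at n = N, where the Turán graph is a maximiser.
ftEq-balanced : ∀ r d s N → 1 ≤ N → N ≡ d * suc (suc r) →
  FtEq (suc s) (d * suc r) (suc (suc r)) (kt (suc s) (turan (suc (suc r)) N)) N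
ftEq-balanced r d s N 1≤N refl =
  (λ { n m _ ((G , G∈ , refl) , _) → density-bound r d s G G∈ })
  , λ a b _ upper → upper N _ 1≤N
      ((Tur , Tur-inClass , refl)
      , λ G G∈ → *-cancelʳ-≤ _ _ N {{>-nonZero 1≤N}} (density-bound r d s G G∈))
  where open BalancedTuran (suc r) d using (Tur; Tur-inClass)

theorem3p5 : (t Δ ω : ℕ) → 2 ≤ Δ → 2 ≤ t → t ≤ ω → (h : (ω ∸ 1) ∣ Δ) →
    FtEq t Δ ω (kt t (turan ω (turanSize Δ ω h))) (turanSize Δ ω h)
theorem3p5 (suc (suc t)) Δ (suc (suc r)) 2≤Δ 2≤t t≤ω (divides d refl) =
  -- With ω = r + 2 and Δ = d (r + 1), the order Δ + d of the Turán graph equals d ω; it is positive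
  -- because Δ is.
  ftEq-balanced r d (suc t) _ (≤-trans (m≤n⇒m≤1+n ≤-refl) (≤-trans 2≤Δ (m≤m+n Δ d)))
    (trans (+-comm Δ d) (sym (*-suc d (suc r))))
theorem3p5 (suc (suc t)) Δ (suc zero) _ _ (s≤s ()) _
theorem3p5 (suc zero) _ _ _ (s≤s ()) _ _
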